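{- There exist constants $c>0$ and $n_0$ such that for every integer $n\ge n_0$ there is a sequence $(G_t)_{t\ge1}$ of connected graphs on a common vertex set $V$ with $|V|=n$ such that, for $\mathcal{P}=(P_{\mathrm{LS}}(G_t))_{t\ge1}$, the pull voting according to $\mathcal{P}$ satisfies $t_{\mathrm{cons}}(\mathcal{P})\ge 2^{cn}$.
   Context: For a connected graph $G$ on $V$ with at least two vertices, $P_{\mathrm{LS}}(G)$ is the transition matrix of the lazy simple random walk: $P_{\mathrm{LS}}(G)(u,u)=1/2$, $P_{\mathrm{LS}}(G)(u,v)=\frac{1}{2\deg(G,u)}$ if $v$ is a neighbour of $u$, and $0$ otherwise. Pull voting according to $\mathcal{P}=(P_t)_{t\ge1}$: each vertex $v\in V$ holds an opinion from a finite set $\Sigma\subseteq\{0,\dots,n-1\}$. At round $t\ge1$, simultaneously and independently, each vertex $u$ picks a vertex $v$ according to $P_t(u,\cdot)$ and replaces its opinion by the opinion that $v$ held at the beginning of the round. $\tau_{\mathrm{cons}}(\mathcal{P})$ is the first time at which all vertices hold the same opinion, and $t_{\mathrm{cons}}(\mathcal{P})=\mathbf{E}[\tau_{\mathrm{cons}}(\mathcal{P})]\in[0,\infty]$, taken for the worst-case initial opinion configuration. -}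

module Defs where

open import Level using (0ℓ)
open import Data.Nat.Base as ℕ using (ℕ; zero; suc; NonZero; >-nonZero)
open import Data.Nat.Properties using (m*n≢0)
open import Data.Integer.Base using (ℤ; +_; -[1+_])
open import Data.Rational using (ℚ; 0ℚ; ½; _/_; _*_; _<_; _⊔_; ↥_; ↧ₙ_)
open import Data.Rational.Properties using (+-*-commutativeRing; *-1-commutativeMonoid)
open import Data.Fin.Base using (Fin; toℕ)
open import Data.Fin.Properties using (_≟_; all?)
open import Data.List.Base using (length; filter; allFin)
open import Data.List.Membership.Propositional using (lose)
open import Data.List.Membership.Propositional.Properties using (∈-allFin)
open import Data.List.Properties using (filter-some)
open import Data.Product.Base using (∃-syntax)
open import Data.Vec.Base using (Vec; []; _∷_; lookup; map)
open import Relation.Binary.Core using (Rel)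
open import Relation.Binary.Definitions using (Decidable; Symmetric; Irreflexive)
open import Relation.Binary.Construct.Closure.ReflexiveTransitive using (Star)
open import Relation.Binary.PropositionalEquality.Core using (_≡_)
open import Relation.Nullary.Decidable using (Dec; yes; no)
open import Relation.Unary using (Pred; _⊆_)
open import Algebra.Bundles using (module CommutativeRing)

open import Algebra.Properties.Semiring.Sum (CommutativeRing.semiring +-*-commutativeRing) public
  using (sum)
open import Algebra.Properties.CommutativeMonoid.Sum *-1-commutativeMonoid public
  using () renaming (sum to product)
open import Algebra.Properties.Semiring.Exp (CommutativeRing.semiring +-*-commutativeRing) public
  using (_^_)

-- An element x of [-∞,∞], given by the set of rationals q with q < x.
ExtReal : Set₁
ExtReal = Pred ℚ 0ℓ

infix 4 _≼_

_≼_ : Rel ExtReal 0ℓ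
x ≼ y = x ⊆ y

fromℚ : ℚ → ExtReal
fromℚ r q = q < r

sup : {I : Set} → (I → ExtReal) → ExtReal
sup x q = ∃[ i ] x i q

2^ℤ_ : ℤ → ℚ
2^ℤ (+ a)    = (+ 2 / 1) ^ a
2^ℤ -[1+ a ] = ½ ^ suc a

-- For e = a/b with b > 0: q < 2^(a/b) iff max(0,q)^b < 2^a.
2^ℚ_ : ℚ → ExtReal
(2^ℚ e) q = (0ℚ ⊔ q) ^ (↧ₙ e) < 2^ℤ (↥ e)

record Graph (n : ℕ) : Set₁ where
  infix 4 _~_ _~?_
  field
    _~_      : Rel (Fin n) 0ℓ
    _~?_     : Decidable _~_
    ~-sym    : Symmetric _~_
    ~-irrefl : Irreflexive _≡_ _~_

  deg : Fin n → ℕ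
  deg u = length (filter (u ~?_) (allFin n))

  ~⇒deg≢0 : ∀ {u v} → u ~ v → NonZero (deg u)
  ~⇒deg≢0 {u} {v} u~v = >-nonZero (filter-some (u ~?_) (lose (∈-allFin v) u~v))

  Connected : Set
  Connected = ∀ u v → Star _~_ u v

Matrix : ℕ → Set
Matrix n = Fin n → Fin n → ℚ

P-LS : ∀ {n} → Graph n → Matrix n
P-LS G u v with u ≟ v
... | yes _ = ½
... | no  _ with Graph._~?_ G u v
...   | yes u~v = _/_ (+ 1) (2 ℕ.* deg u) {{m*n≢0 2 (deg u) {{_}} {{~⇒deg≢0 u~v}}}}
  where open Graph G
...   | no  _   = 0ℚ

-- The opinion held by each vertex; opinions are elements of {0,…,n-1}.
Config : ℕ → Set
Config n = Vec (Fin n) n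

-- The vertex picked by each vertex in one round.
Picks : ℕ → Set
Picks n = Vec (Fin n) n

update : ∀ {n} → Picks n → Config n → Config n
update φ x = map (lookup x) φ

Consensus : ∀ {n} → Config n → Set
Consensus x = ∀ u v → lookup x u ≡ lookup x v

consensus? : ∀ {n} (x : Config n) → Dec (Consensus x)
consensus? x = all? λ u → all? λ v → lookup x u ≟ lookup x v

-- min(τ,T), where τ is the first time t ≥ 0 at which the opinions agree, when
-- the initial configuration is x and ω lists the picks of the first T rounds.
τ∧ : ∀ {n} T → Config n → Vec (Picks n) T → ℕ
τ∧ zero    x []      = 0
τ∧ (suc T) x (φ ∷ ω) with consensus? x
... | yes _ = 0
... | no  _ = suc (τ∧ T (update φ x) ω)

-- Given summation over A, summation over all vectors in A of length m.
sumVec : {A : Set} → ((A → ℚ) → ℚ) → ∀ m → (Vec A m → ℚ) → ℚ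
sumVec sumA zero    f = f []
sumVec sumA (suc m) f = sumA λ a → sumVec sumA m λ as → f (a ∷ as)

-- The transition matrices P₁, P₂, … are indexed from 0: P t drives round t + 1.
-- All picks, over all vertices and all rounds, are independent.
prob : ∀ {n} → (ℕ → Matrix n) → ∀ T → Vec (Picks n) T → ℚ
prob {n} P T ω =
  product λ (t : Fin T) → product λ (u : Fin n) → P (toℕ t) u (lookup (lookup ω t) u)

-- Expectation of a function of the picks of the first T rounds.
𝔼 : ∀ {n} → (ℕ → Matrix n) → ∀ T → (Vec (Picks n) T → ℚ) → ℚ
𝔼 {n} P T f = sumVec (sumVec sum n) T λ ω → prob P T ω * f ω

-- By monotone convergence, E[τ] = sup_T E[min(τ,T)], which is ∞ when τ = ∞ has
-- positive probability; the outer supremum is over initial configurations.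
t-cons : ∀ {n} → (ℕ → Matrix n) → ExtReal
t-cons {n} P = sup λ (x : Config n) → sup λ (T : ℕ) → fromℚ (𝔼 P T λ ω → + τ∧ T x ω / 1)

{-# OPTIONS --safe #-}
-- Split the vertices into two halves holding opposite opinions. In each round
-- each half is a star, the two centres are joined, and the centres rotate
-- cyclically. The centre is the only vertex that can pick the other opinion
-- across the bridge, or spread its opinion to the rest of its half; but by the
-- time it is centre again it has been, for a full period, a leaf copying the
-- current centre with probability 1/2 per round. Weighting a vertex that will be
-- centre in j rounds by 2^-j, the expected weight Φ of the vertices with the
-- wrong opinion grows by at most 2^-L + 2^-L' per round, where L + 1 and L' + 1
-- are the sizes of the halves. At consensus one of the two centres is wrong and
-- Φ ≥ 1, so consensus is unlikely before time of order 2^min(L,L').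
module Submission where

open import Defs
open import Algebra.Bundles using (module CommutativeRing)
open import Data.Bool.Base using (Bool; true; false; not)
import Data.Bool.Properties as Bool
open import Data.Empty using (⊥)
open import Data.Fin.Base using (Fin; zero; suc; toℕ; fromℕ; inject₁; punchIn)
open import Data.Fin.Permutation as Perm
  using (Permutation′; insert; insert-punchIn; _⟨$⟩ʳ_; _⟨$⟩ˡ_)
import Data.Fin.Properties as Fin
open import Data.Integer.Base as ℤ using (+_; -[1+_])
import Data.Integer.Properties as ℤ
open import Data.List.Base as List using (length; filter)
open import Data.Nat.Base as ℕ using (ℕ; zero; suc; _≥_; z≤n; s≤s)
import Data.Nat.Properties as ℕ
open import Data.Nat.Tactic.RingSolver using (solve-∀)
open import Data.Product.Base using (_×_; _,_; proj₁; proj₂; ∃-syntax; Σ-syntax)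
open import Data.Rational
  using (ℚ; 0ℚ; 1ℚ; ½; _/_; _+_; _*_; _<_; _≤_; _⊔_; Positive; nonNegative; ↥_; ↧ₙ_; toℚᵘ)
open import Data.Rational.Properties
open import Data.Rational.Solver using (module +-*-Solver)
import Data.Rational.Unnormalised.Base as ℚᵘ
import Data.Rational.Unnormalised.Properties as ℚᵘ
open import Data.Sum.Base using (_⊎_; inj₁; inj₂)
open import Data.Vec.Base using (Vec; []; _∷_; lookup; tabulate)
open import Data.Vec.Properties using (lookup-map; lookup∘tabulate)
open import Function.Base using (_∘_; id)
open import Function.Bundles using (_↔_; Inverse; mk↔ₛ′)
open import Function.Construct.Composition using (_↔-∘_)
open import Relation.Binary.Construct.Closure.ReflexiveTransitive
  using (Star; ε; _◅_; _◅◅_; reverse; gmap)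
open import Relation.Binary.PropositionalEquality
open import Relation.Nullary using (¬_; Dec; yes; no; ¬?; contradiction)
open import Relation.Unary as U using (Pred)

open import Algebra.Properties.Semiring.Exp (CommutativeRing.semiring +-*-commutativeRing)
  using (^-assocʳ)
open import Algebra.Properties.Semiring.Sum (CommutativeRing.semiring +-*-commutativeRing)
  using (sum-cong-≗; ∑-distrib-+; *-distribˡ-sum; *-distribʳ-sum; sum-init-last; sum-replicate-zero)
open +-*-Solver using (solve; _:=_; _:+_; _:*_; con)

-- Inequalities and finite sums of rationals

*-monoˡ : ∀ {p q r} → 0ℚ ≤ r → p ≤ q → r * p ≤ r * q
*-monoˡ {r = r} 0≤r = *-monoˡ-≤-nonNeg r {{nonNegative 0≤r}}

*-nonNeg : ∀ {p q} → 0ℚ ≤ p → 0ℚ ≤ q → 0ℚ ≤ p * q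
*-nonNeg {p} {q} 0≤p 0≤q = ≤-trans (≤-reflexive (sym (*-zeroʳ p))) (*-monoˡ 0≤p 0≤q)

+-nonNeg : ∀ {p q} → 0ℚ ≤ p → 0ℚ ≤ q → 0ℚ ≤ p + q
+-nonNeg = +-mono-≤

p≤p+q : ∀ {p q} → 0ℚ ≤ q → p ≤ p + q
p≤p+q {p} 0≤q = ≤-trans (≤-reflexive (sym (+-identityʳ p))) (+-monoʳ-≤ p 0≤q)

p≤q+p : ∀ {p q} → 0ℚ ≤ q → p ≤ q + p
p≤q+p {p} 0≤q = ≤-trans (≤-reflexive (sym (+-identityˡ p))) (+-monoˡ-≤ p 0≤q)

0≤½ : 0ℚ ≤ ½
0≤½ = ≤ᵇ⇒≤ _

0≤1 : 0ℚ ≤ 1ℚ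
0≤1 = ≤ᵇ⇒≤ _

sum-mono : ∀ {n} {f g : Fin n → ℚ} → (∀ i → f i ≤ g i) → sum f ≤ sum g
sum-mono {zero}  f≤g = ≤-refl
sum-mono {suc n} f≤g = +-mono-≤ (f≤g zero) (sum-mono (f≤g ∘ suc))

sum-nonNeg : ∀ {n} {f : Fin n → ℚ} → (∀ i → 0ℚ ≤ f i) → 0ℚ ≤ sum f
sum-nonNeg {zero}  0≤f = ≤-refl
sum-nonNeg {suc n} 0≤f = +-nonNeg (0≤f zero) (sum-nonNeg (0≤f ∘ suc))

x*[y*z]≡y*[x*z] : ∀ x y z → x * (y * z) ≡ y * (x * z)
x*[y*z]≡y*[x*z] = solve 3 (λ x y z → x :* (y :* z) := y :* (x :* z)) refl

-- Expectations as positive, linear, normalised functionals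

record IsExpectation {A : Set} (E : (A → ℚ) → ℚ) : Set where
  field
    mono   : ∀ {f g} → (∀ a → f a ≤ g a) → E f ≤ E g
    +-homo : ∀ f g → E (λ a → f a + g a) ≡ E f + E g
    *-homo : ∀ c f → E (λ a → c * f a) ≡ c * E f
    const  : ∀ c → E (λ _ → c) ≡ c

  ≗-cong : ∀ {f g} → (∀ a → f a ≡ g a) → E f ≡ E g
  -- Pointwise equal functions need not be propositionally equal, so congruence comes from
  -- monotonicity applied in both directions.
  ≗-cong f≗g = ≤-antisym (mono (≤-reflexive ∘ f≗g)) (mono (≤-reflexive ∘ sym ∘ f≗g))

  sum-homo : ∀ {n} (f : Fin n → A → ℚ) → E (λ a → sum λ i → f i a) ≡ sum λ i → E (f i)
  sum-homo {zero}  f = const 0ℚ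
  sum-homo {suc n} f = trans
    (+-homo (f zero) (λ a → sum λ i → f (suc i) a))
    (cong (_+_ (E (f zero))) (sum-homo (f ∘ suc)))

isExpectation-resp : {A : Set} {E E′ : (A → ℚ) → ℚ} →
  (∀ f → E′ f ≡ E f) → IsExpectation E → IsExpectation E′
isExpectation-resp eq e = record
  { mono   = λ f≤g → subst₂ _≤_ (sym (eq _)) (sym (eq _)) (mono f≤g)
  ; +-homo = λ f g → trans (eq _) (trans (+-homo f g) (sym (cong₂ _+_ (eq f) (eq g))))
  ; *-homo = λ c f → trans (eq _) (trans (*-homo c f) (cong (c *_) (sym (eq f))))
  ; const  = λ c → trans (eq _) (const c)
  } where open IsExpectation e

isExpectation-[] : {A : Set} → IsExpectation {Vec A 0} λ f → f []
isExpectation-[] = record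
  { mono   = λ f≤g → f≤g []
  ; +-homo = λ _ _ → refl
  ; *-homo = λ _ _ → refl
  ; const  = λ _ → refl
  }

isExpectation-∷ : {A : Set} {m : ℕ} {E : (A → ℚ) → ℚ} {F : (Vec A m → ℚ) → ℚ} →
  IsExpectation E → IsExpectation F →
  IsExpectation λ f → E λ a → F λ as → f (a ∷ as)
isExpectation-∷ {E = E} {F} e f = record
  { mono   = λ g≤h → E.mono λ a → F.mono λ as → g≤h (a ∷ as)
  ; +-homo = λ g h → trans
      (E.≗-cong λ a → F.+-homo (λ as → g (a ∷ as)) (λ as → h (a ∷ as)))
      (E.+-homo (λ a → F λ as → g (a ∷ as)) (λ a → F λ as → h (a ∷ as)))
  ; *-homo = λ c g → trans
      (E.≗-cong λ a → F.*-homo c λ as → g (a ∷ as))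
      (E.*-homo c λ a → F λ as → g (a ∷ as))
  ; const  = λ c → trans (E.≗-cong λ a → F.const c) (E.const c)
  }
  where
  module E = IsExpectation e
  module F = IsExpectation f

-- The unweighted sum over all picks is not normalised, hence no expectation. These two laws are
-- what is used to move the weight of the first coordinate out of the sum over the others.
record IsSummation {A : Set} (S : (A → ℚ) → ℚ) : Set where
  field
    ≗-cong : ∀ {f g} → (∀ a → f a ≡ g a) → S f ≡ S g
    *-homo : ∀ c f → S (λ a → c * f a) ≡ c * S f

sum-isSummation : ∀ {n} → IsSummation (sum {n})
sum-isSummation {n} = record
  { ≗-cong = sum-cong-≗ {n}
  ; *-homo = λ c f → sym (*-distribˡ-sum {n} c f)
  }

sumVec-isSummation : {A : Set} {S : (A → ℚ) → ℚ} →
  IsSummation S → ∀ m → IsSummation (sumVec S m)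
sumVec-isSummation s zero = record
  { ≗-cong = λ f≗g → f≗g []
  ; *-homo = λ _ _ → refl
  }
sumVec-isSummation {S = S} s (suc m) = record
  { ≗-cong = λ f≗g → S.≗-cong λ a → M.≗-cong λ as → f≗g (a ∷ as)
  ; *-homo = λ c f → trans
      (S.≗-cong λ a → M.*-homo c λ as → f (a ∷ as))
      (S.*-homo c λ a → sumVec S m λ as → f (a ∷ as))
  }
  where
  module S = IsSummation s
  module M = IsSummation (sumVec-isSummation s m)

-- The factor `p a` is constant for the inner sum `R`, so a product weight becomes an iterated sum.
-- It serves twice: to split off one vertex within a round, and one round from a history.
summation-product : {A B : Set} {S : (A → ℚ) → ℚ} {R : (B → ℚ) → ℚ} →
  IsSummation S → IsSummation R → (p : A → ℚ) (q : B → ℚ) (f : A → B → ℚ) →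
  S (λ a → R λ b → (p a * q b) * f a b) ≡ S (λ a → p a * R λ b → q b * f a b)
summation-product s r p q f = S.≗-cong λ a → trans
  (R.≗-cong λ b → *-assoc (p a) (q b) (f a b))
  (R.*-homo (p a) λ b → q b * f a b)
  where
  module S = IsSummation s
  module R = IsSummation r

-- Independent picks: one round and several rounds

record IsDistribution {n} (p : Fin n → ℚ) : Set where
  field
    nonNeg : ∀ v → 0ℚ ≤ p v
    total  : sum p ≡ 1ℚ

distribution-expectation : ∀ {n} {p : Fin n → ℚ} →
  IsDistribution p → IsExpectation λ f → sum λ v → p v * f v
distribution-expectation {n} {p} d = record
  { mono   = λ f≤g → sum-mono λ v → *-monoˡ (nonNeg v) (f≤g v)
  ; +-homo = λ f g → trans
      (sum-cong-≗ {n} λ v → *-distribˡ-+ (p v) (f v) (g v))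
      (∑-distrib-+ {n} (λ v → p v * f v) λ v → p v * g v)
  ; *-homo = λ c f → trans
      (sum-cong-≗ {n} λ v → x*[y*z]≡y*[x*z] (p v) c (f v))
      (sym (*-distribˡ-sum {n} c λ v → p v * f v))
  ; const  = λ c → trans (sym (*-distribʳ-sum {n} c p)) (trans (cong (_* c) total) (*-identityˡ c))
  } where open IsDistribution d

-- The `m` picking rows are counted separately from the `n` values that can be picked, which permits
-- induction on the rows; `m = n` is one round of voting.
𝔼₁ : ∀ {m n} → (Fin m → Fin n → ℚ) → (Vec (Fin n) m → ℚ) → ℚ
𝔼₁ {m} P f = sumVec sum m λ φ → product (λ u → P u (lookup φ u)) * f φ

𝔼₁-∷ : ∀ {m n} (P : Fin (suc m) → Fin n → ℚ) (f : Vec (Fin n) (suc m) → ℚ) →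
  𝔼₁ P f ≡ sum λ a → P zero a * 𝔼₁ (P ∘ suc) λ φ → f (a ∷ φ)
𝔼₁-∷ {m} {n} P f =
  summation-product {S = sum {n}} {sumVec sum m} sum-isSummation (sumVec-isSummation sum-isSummation m)
    (P zero) (λ φ → product λ u → P (suc u) (lookup φ u)) (λ a φ → f (a ∷ φ))

𝔼₁-isExpectation : ∀ {m n} {P : Fin m → Fin n → ℚ} →
  (∀ u → IsDistribution (P u)) → IsExpectation (𝔼₁ P)
𝔼₁-isExpectation {zero}  d = isExpectation-resp {E = λ f → f []} (λ f → *-identityˡ (f [])) isExpectation-[]
𝔼₁-isExpectation {suc m} {P = P} d = isExpectation-resp (𝔼₁-∷ P)
  (isExpectation-∷ (distribution-expectation (d zero)) (𝔼₁-isExpectation (d ∘ suc)))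

-- By independence the rows other than `u` integrate to 1: those after `u` in the base case, those
-- before it one at a time in the induction.
𝔼₁-marginal : ∀ {m n} {P : Fin m → Fin n → ℚ} → (∀ u → IsDistribution (P u)) →
  ∀ u (f : Fin n → ℚ) → 𝔼₁ P (λ φ → f (lookup φ u)) ≡ sum λ v → P u v * f v
𝔼₁-marginal {n = n} {P} d zero f = trans (𝔼₁-∷ P λ φ → f (lookup φ zero)) (sum-cong-≗ {n} λ a →
  cong (P zero a *_) (IsExpectation.const (𝔼₁-isExpectation (d ∘ suc)) (f a)))
𝔼₁-marginal {n = n} {P} d (suc u) f = trans (𝔼₁-∷ P λ φ → f (lookup φ (suc u))) (trans
  (sum-cong-≗ {n} λ a → cong (P zero a *_) (𝔼₁-marginal (d ∘ suc) u f))
  (IsExpectation.const (distribution-expectation (d zero)) (sum λ v → P (suc u) v * f v)))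

-- First-step decomposition: after the first round the process is driven by the shifted sequence
-- `P ∘ suc`.
𝔼-∷ : ∀ {n} (P : ℕ → Matrix n) T (f : Vec (Picks n) (suc T) → ℚ) →
  𝔼 P (suc T) f ≡ 𝔼₁ (P 0) λ φ → 𝔼 (P ∘ suc) T λ ω → f (φ ∷ ω)
𝔼-∷ {n} P T f =
  summation-product {S = sumVec sum n} {R = sumVec (sumVec sum n) T} picks (sumVec-isSummation picks T)
    (λ φ → product λ u → P 0 u (lookup φ u)) (prob (P ∘ suc) T) (λ φ ω → f (φ ∷ ω))
  where
  picks : IsSummation (sumVec (sum {n}) n)
  picks = sumVec-isSummation sum-isSummation n

𝔼-isExpectation : ∀ {n} {P : ℕ → Matrix n} → (∀ t u → IsDistribution (P t u)) →
  ∀ T → IsExpectation (𝔼 P T)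
𝔼-isExpectation d zero    = isExpectation-resp {E = λ f → f []} (λ f → *-identityˡ (f [])) isExpectation-[]
𝔼-isExpectation {P = P} d (suc T) = isExpectation-resp (𝔼-∷ P T)
  (isExpectation-∷ (𝔼₁-isExpectation (d 0)) (𝔼-isExpectation (d ∘ suc) T))

-- Natural numbers as rationals

/1-homo-+ : ∀ a b → + (a ℕ.+ b) / 1 ≡ + a / 1 + + b / 1
/1-homo-+ a b = toℚᵘ-injective (begin
  toℚᵘ (+ (a ℕ.+ b) / 1)               ≈⟨ toℚᵘ-fromℚᵘ (+ (a ℕ.+ b) ℚᵘ./ 1) ⟩
  + (a ℕ.+ b) ℚᵘ./ 1                   ≈⟨ ℚᵘ.*≡* (cong (ℤ._* + 1) (sym
                                            (cong₂ ℤ._+_ (ℤ.*-identityʳ (+ a)) (ℤ.*-identityʳ (+ b))))) ⟩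
  (+ a ℚᵘ./ 1) ℚᵘ.+ (+ b ℚᵘ./ 1)       ≈⟨ ℚᵘ.+-cong (toℚᵘ-fromℚᵘ (+ a ℚᵘ./ 1)) (toℚᵘ-fromℚᵘ (+ b ℚᵘ./ 1)) ⟨
  toℚᵘ (+ a / 1) ℚᵘ.+ toℚᵘ (+ b / 1)   ≈⟨ toℚᵘ-homo-+ (+ a / 1) (+ b / 1) ⟨
  toℚᵘ (+ a / 1 + + b / 1)             ∎)
  where open ℚᵘ.≃-Reasoning

/1-homo-* : ∀ a b → + (a ℕ.* b) / 1 ≡ (+ a / 1) * (+ b / 1)
/1-homo-* zero    b = sym (*-zeroˡ (+ b / 1))
/1-homo-* (suc a) b = begin
  + (b ℕ.+ a ℕ.* b) / 1                    ≡⟨ /1-homo-+ b (a ℕ.* b) ⟩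
  + b / 1 + + (a ℕ.* b) / 1                ≡⟨ cong (_+_ (+ b / 1)) (/1-homo-* a b) ⟩
  + b / 1 + (+ a / 1) * (+ b / 1)          ≡⟨ solve 2 (λ x y → y :+ x :* y := (con 1ℚ :+ x) :* y) refl (+ a / 1) (+ b / 1) ⟩
  (1ℚ + + a / 1) * (+ b / 1)               ≡⟨ cong (_* (+ b / 1)) (/1-homo-+ 1 a) ⟨
  (+ suc a / 1) * (+ b / 1)                ∎
  where open ≡-Reasoning

0≤/ : ∀ a b .{{_ : ℕ.NonZero b}} → 0ℚ ≤ + a / b
0≤/ a b = nonNegative⁻¹ _ {{normalize-nonNeg a b}}

1/2d*d : ∀ d .{{_ : ℕ.NonZero (2 ℕ.* d)}} → (+ 1 / (2 ℕ.* d)) * (+ d / 1) ≡ ½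
1/2d*d (suc d) = toℚᵘ-injective (begin
  toℚᵘ ((+ 1 / (2 ℕ.* suc d)) * (+ suc d / 1))
    ≈⟨ toℚᵘ-homo-* (+ 1 / (2 ℕ.* suc d)) (+ suc d / 1) ⟩
  toℚᵘ (+ 1 / (2 ℕ.* suc d)) ℚᵘ.* toℚᵘ (+ suc d / 1)
    ≈⟨ ℚᵘ.*-cong (toℚᵘ-fromℚᵘ (+ 1 ℚᵘ./ (2 ℕ.* suc d))) (toℚᵘ-fromℚᵘ (+ suc d ℚᵘ./ 1)) ⟩
  (+ 1 ℚᵘ./ (2 ℕ.* suc d)) ℚᵘ.* (+ suc d ℚᵘ./ 1)
    ≈⟨ ℚᵘ.*≡* (cong +_ (lem d)) ⟩
  toℚᵘ ½ ∎)
  where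
  open ℚᵘ.≃-Reasoning
  lem : ∀ d → (suc d ℕ.+ 0) ℕ.* 2 ≡ 2 ℕ.* suc d ℕ.* 1 ℕ.+ 0
  lem = solve-∀

-- Indicators and degrees

ind : {A : Set} → Dec A → ℚ
ind (yes _) = 1ℚ
ind (no  _) = 0ℚ

ind-nonNeg : {A : Set} (A? : Dec A) → 0ℚ ≤ ind A?
ind-nonNeg (yes _) = 0≤1
ind-nonNeg (no  _) = ≤-refl

ind-≤1 : {A : Set} (A? : Dec A) → ind A? ≤ 1ℚ
ind-≤1 (yes _) = ≤-refl
ind-≤1 (no  _) = 0≤1

-- Stated for `tabulate f` because the induction shifts `f`; at `f = id` it turns the degree, the
-- length of a filtered `allFin`, into a sum of indicators.
length-filter-tabulate : ∀ {n} {A : Set} {P : Pred A _} (P? : U.Decidable P) (f : Fin n → A) →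
  + length (filter P? (List.tabulate f)) / 1 ≡ sum λ i → ind (P? (f i))
length-filter-tabulate {zero}  P? f = refl
length-filter-tabulate {suc n} P? f with P? (f zero)
... | yes _ = trans
  (/1-homo-+ 1 (length (filter P? (List.tabulate (f ∘ suc)))))
  (cong (_+_ 1ℚ) (length-filter-tabulate P? (f ∘ suc)))
... | no  _ = trans
  (length-filter-tabulate P? (f ∘ suc))
  (sym (+-identityˡ (sum λ i → ind (P? (f (suc i))))))

ind-suc : ∀ {n} (u v : Fin n) → ind (suc u Fin.≟ suc v) ≡ ind (u Fin.≟ v)
ind-suc u v with u Fin.≟ v
... | yes _ = refl
... | no  _ = refl

sum-ind-≟ : ∀ {n} (u : Fin n) (f : Fin n → ℚ) → sum (λ v → ind (u Fin.≟ v) * f v) ≡ f u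
sum-ind-≟ {suc n} zero f = begin
  1ℚ * f zero + sum (λ v → 0ℚ * f (suc v))  ≡⟨ cong₂ _+_ (*-identityˡ (f zero)) (sum-cong-≗ {n} λ v → *-zeroˡ (f (suc v))) ⟩
  f zero + sum {n} (λ _ → 0ℚ)               ≡⟨ cong (_+_ (f zero)) (sum-replicate-zero n) ⟩
  f zero + 0ℚ                               ≡⟨ +-identityʳ (f zero) ⟩
  f zero                                    ∎
  where open ≡-Reasoning
sum-ind-≟ {suc n} (suc u) f = begin
  0ℚ * f zero + sum (λ v → ind (suc u Fin.≟ suc v) * f (suc v))
    ≡⟨ cong₂ _+_ (*-zeroˡ (f zero)) (sum-cong-≗ {n} λ v → cong (_* f (suc v)) (ind-suc u v)) ⟩
  0ℚ + sum (λ v → ind (u Fin.≟ v) * f (suc v))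
    ≡⟨ +-identityˡ (sum λ v → ind (u Fin.≟ v) * f (suc v)) ⟩
  sum (λ v → ind (u Fin.≟ v) * f (suc v))
    ≡⟨ sum-ind-≟ u (f ∘ suc) ⟩
  f (suc u) ∎
  where open ≡-Reasoning

-- One step of the lazy walk

module LazyWalk {n} (G : Graph n) (u : Fin n) {w : Fin n} (u~w : Graph._~_ G u w) where
  open Graph G

  private instance
    2deg≢0 : ℕ.NonZero (2 ℕ.* deg u)
    2deg≢0 = ℕ.m*n≢0 2 (deg u) {{_}} {{~⇒deg≢0 u~w}}

  q : ℚ
  q = + 1 / (2 ℕ.* deg u)

  -- At `v = u` the neighbour term vanishes because there are no loops. The case distinction of
  -- `P-LS` becomes a linear formula with one denominator, whose being nonzero is witnessed by the
  -- fixed neighbour `w`.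
  P-LS-split : ∀ v → P-LS G u v ≡ ½ * ind (u Fin.≟ v) + q * ind (u ~? v)
  P-LS-split v with u Fin.≟ v
  ... | yes refl with u ~? u
  ...   | yes u~u = contradiction u~u (~-irrefl refl)
  ...   | no  _   = sym (cong (_+_ (½ * 1ℚ)) (*-zeroʳ q))
  P-LS-split v | no _ with u ~? v
  ...   | yes _ = sym (trans (+-identityˡ (q * 1ℚ)) (*-identityʳ q))
  ...   | no  _ = sym (trans (+-identityˡ (q * 0ℚ)) (*-zeroʳ q))

  sum-P-LS : (f : Fin n → ℚ) → sum (λ v → P-LS G u v * f v) ≡ ½ * f u + q * sum (λ v → ind (u ~? v) * f v)
  sum-P-LS f = begin
    sum (λ v → P-LS G u v * f v)
      ≡⟨ (sum-cong-≗ {n} λ v → trans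
           (cong (_* f v) (P-LS-split v))
           (distrib ½ q (ind (u Fin.≟ v)) (ind (u ~? v)) (f v))) ⟩
    sum (λ v → ½ * (ind (u Fin.≟ v) * f v) + q * (ind (u ~? v) * f v))
      ≡⟨ ∑-distrib-+ {n} (λ v → ½ * (ind (u Fin.≟ v) * f v)) (λ v → q * (ind (u ~? v) * f v)) ⟩
    sum (λ v → ½ * (ind (u Fin.≟ v) * f v)) + sum (λ v → q * (ind (u ~? v) * f v))
      ≡⟨ cong₂ _+_
           (*-distribˡ-sum {n} ½ λ v → ind (u Fin.≟ v) * f v)
           (*-distribˡ-sum {n} q λ v → ind (u ~? v) * f v) ⟨
    ½ * sum (λ v → ind (u Fin.≟ v) * f v) + q * sum (λ v → ind (u ~? v) * f v)
      ≡⟨ cong (λ x → ½ * x + q * sum (λ v → ind (u ~? v) * f v)) (sum-ind-≟ u f) ⟩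
    ½ * f u + q * sum (λ v → ind (u ~? v) * f v) ∎
    where
    open ≡-Reasoning
    distrib : ∀ a b x y z → (a * x + b * y) * z ≡ a * (x * z) + b * (y * z)
    distrib = solve 5 (λ a b x y z → (a :* x :+ b :* y) :* z := a :* (x :* z) :+ b :* (y :* z)) refl

  q*deg : ∀ c → q * sum (λ v → ind (u ~? v) * c) ≡ ½ * c
  q*deg c = begin
    q * sum (λ v → ind (u ~? v) * c)   ≡⟨ cong (q *_) (*-distribʳ-sum {n} c λ v → ind (u ~? v)) ⟨
    q * (sum (λ v → ind (u ~? v)) * c) ≡⟨ *-assoc q (sum λ v → ind (u ~? v)) c ⟨
    q * sum (λ v → ind (u ~? v)) * c   ≡⟨ cong (λ d → q * d * c) (length-filter-tabulate (u ~?_) id) ⟨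
    q * (+ deg u / 1) * c              ≡⟨ cong (_* c) (1/2d*d (deg u)) ⟩
    ½ * c                              ∎
    where open ≡-Reasoning

  isDistribution : IsDistribution (P-LS G u)
  isDistribution = record
    { nonNeg = λ v → subst (0ℚ ≤_) (sym (P-LS-split v))
        (+-nonNeg (*-nonNeg 0≤½ (ind-nonNeg (u Fin.≟ v))) (*-nonNeg (0≤/ 1 (2 ℕ.* deg u)) (ind-nonNeg (u ~? v))))
    ; total  = begin
        sum (P-LS G u)                                      ≡⟨ (sum-cong-≗ {n} λ v → *-identityʳ (P-LS G u v)) ⟨
        sum (λ v → P-LS G u v * 1ℚ)                         ≡⟨ sum-P-LS (λ _ → 1ℚ) ⟩
        ½ * 1ℚ + q * sum (λ v → ind (u ~? v) * 1ℚ)          ≡⟨ cong (_+_ (½ * 1ℚ)) (q*deg 1ℚ) ⟩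
        ½ * 1ℚ + ½ * 1ℚ                                     ∎
    } where open ≡-Reasoning

  -- Half of the mass stays at `u` and the neighbours share the other half. For a leaf, `K` will be
  -- the value at its centre.
  step-≤ : (f : Fin n → ℚ) (K : ℚ) → (∀ v → u ~ v → f v ≤ K) → sum (λ v → P-LS G u v * f v) ≤ ½ * f u + ½ * K
  step-≤ f K f≤K = begin
    sum (λ v → P-LS G u v * f v)                   ≡⟨ sum-P-LS f ⟩
    ½ * f u + q * sum (λ v → ind (u ~? v) * f v)   ≤⟨ +-monoʳ-≤ (½ * f u) (*-monoˡ (0≤/ 1 (2 ℕ.* deg u)) (sum-mono bound)) ⟩
    ½ * f u + q * sum (λ v → ind (u ~? v) * K)     ≡⟨ cong (_+_ (½ * f u)) (q*deg K) ⟩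
    ½ * f u + ½ * K                                ∎
    where
    open ≤-Reasoning
    bound : ∀ v → ind (u ~? v) * f v ≤ ind (u ~? v) * K
    bound v with u ~? v
    ... | yes u~v = *-monoˡ 0≤1 (f≤K v u~v)
    ... | no  _   = ≤-reflexive (trans (*-zeroˡ (f v)) (sym (*-zeroˡ K)))

-- Powers of two and real exponents

2ℚ : ℚ
2ℚ = + 2 / 1

0≤2 : 0ℚ ≤ 2ℚ
0≤2 = ≤ᵇ⇒≤ _

1≤2 : 1ℚ ≤ 2ℚ
1≤2 = ≤ᵇ⇒≤ _

½≤1 : ½ ≤ 1ℚ
½≤1 = ≤ᵇ⇒≤ _

^-nonNeg : ∀ {p} → 0ℚ ≤ p → ∀ k → 0ℚ ≤ p ^ k
^-nonNeg 0≤p zero    = 0≤1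
^-nonNeg 0≤p (suc k) = *-nonNeg 0≤p (^-nonNeg 0≤p k)

^-monoˡ-≤ : ∀ {p q} → 0ℚ ≤ p → p ≤ q → ∀ k → p ^ k ≤ q ^ k
^-monoˡ-≤ 0≤p p≤q zero = ≤-refl
^-monoˡ-≤ {p} {q} 0≤p p≤q (suc k) = ≤-trans
  (*-monoˡ 0≤p (^-monoˡ-≤ 0≤p p≤q k))
  (*-monoʳ-≤-nonNeg (q ^ k) {{nonNegative (^-nonNeg (≤-trans 0≤p p≤q) k)}} p≤q)

1≤2^ : ∀ k → 1ℚ ≤ 2ℚ ^ k
1≤2^ zero    = ≤-refl
1≤2^ (suc k) = ≤-trans 1≤2 (≤-trans (≤-reflexive (sym (*-identityʳ 2ℚ))) (*-monoˡ 0≤2 (1≤2^ k)))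

2^-mono-≤ : ∀ {k l} → k ℕ.≤ l → 2ℚ ^ k ≤ 2ℚ ^ l
2^-mono-≤ {l = l} z≤n = 1≤2^ l
2^-mono-≤ (s≤s k≤l)   = *-monoˡ 0≤2 (2^-mono-≤ k≤l)

½^≤1 : ∀ k → ½ ^ k ≤ 1ℚ
½^≤1 zero    = ≤-refl
½^≤1 (suc k) = ≤-trans (*-monoˡ 0≤½ (½^≤1 k)) ½≤1

½^-anti-≤ : ∀ {k l} → k ℕ.≤ l → ½ ^ l ≤ ½ ^ k
½^-anti-≤ {l = l} z≤n = ½^≤1 l
½^-anti-≤ (s≤s k≤l)   = *-monoˡ 0≤½ (½^-anti-≤ k≤l)

2^*½^ : ∀ k → 2ℚ ^ k * ½ ^ k ≡ 1ℚ
2^*½^ zero    = refl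
2^*½^ (suc k) = begin
  2ℚ * 2ℚ ^ k * (½ * ½ ^ k)   ≡⟨ regroup (2ℚ ^ k) (½ ^ k) ⟩
  2ℚ ^ k * ½ ^ k              ≡⟨ 2^*½^ k ⟩
  1ℚ                          ∎
  where
  open ≡-Reasoning
  regroup : ∀ x y → 2ℚ * x * (½ * y) ≡ x * y
  regroup = solve 2 (λ x y → con 2ℚ :* x :* (con ½ :* y) := x :* y) refl

/1-2^ : ∀ k → + (2 ℕ.^ k) / 1 ≡ 2ℚ ^ k
/1-2^ zero    = refl
/1-2^ (suc k) = trans (/1-homo-* 2 (2 ℕ.^ k)) (cong (2ℚ *_) (/1-2^ k))

2^ℤ-≤ : ∀ {a k} → a ℤ.≤ + k → 2^ℤ a ≤ 2ℚ ^ k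
2^ℤ-≤ {+ a}      {k} a≤k = 2^-mono-≤ (ℤ.drop‿+≤+ a≤k)
2^ℤ-≤ { -[1+ a ]} {k} _  = ≤-trans (½^≤1 (suc a)) (1≤2^ k)

-- Write `e = a/b`. If `2^k ≤ q`, raising to the power `b` gives `2^a ≤ 2^(kb) ≤ max(0,q)^b`,
-- against the definition of `2^ℚ e`.
2^ℚ-< : ∀ {e q} k → e ≤ + k / 1 → (2^ℚ e) q → q < 2ℚ ^ k
2^ℚ-< {e} {q} k e≤k q∈ = ≰⇒> λ 2^k≤q → <-irrefl refl (≤-<-trans (chain 2^k≤q) q∈)
  where
  open ≤-Reasoning
  b = ↧ₙ e

  -- Clearing denominators in `e ≤ k`, in the unnormalised rationals, where the order is
  -- cross-multiplication.
  exponent : ↥ e ℤ.≤ + (k ℕ.* b)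
  exponent = subst₂ ℤ._≤_
    (trans (ℤ.*-identityʳ (ℚᵘ.↥ toℚᵘ e)) (↥ᵘ-toℚᵘ e))
    (trans (cong (+ k ℤ.*_) (↧ᵘ-toℚᵘ e)) (sym (ℤ.pos-* k b)))
    (ℚᵘ.drop-*≤* (ℚᵘ.≤-respʳ-≃ (toℚᵘ-fromℚᵘ (+ k ℚᵘ./ 1)) (toℚᵘ-mono-≤ e≤k)))

  chain : 2ℚ ^ k ≤ q → 2^ℤ (↥ e) ≤ (0ℚ ⊔ q) ^ b
  chain 2^k≤q = begin
    2^ℤ (↥ e)       ≤⟨ 2^ℤ-≤ exponent ⟩
    2ℚ ^ (k ℕ.* b)  ≡⟨ ^-assocʳ 2ℚ k b ⟨
    (2ℚ ^ k) ^ b    ≤⟨ ^-monoˡ-≤ (^-nonNeg 0≤2 k) (≤-trans 2^k≤q (p≤q⊔p 0ℚ q)) b ⟩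
    (0ℚ ⊔ q) ^ b    ∎

/1-mono-≤ : ∀ {a b} → a ℕ.≤ b → + a / 1 ≤ + b / 1
/1-mono-≤ {a} {b} a≤b = begin
  + a / 1                      ≤⟨ p≤p+q (0≤/ (b ℕ.∸ a) 1) ⟩
  + a / 1 + + (b ℕ.∸ a) / 1    ≡⟨ /1-homo-+ a (b ℕ.∸ a) ⟨
  + (a ℕ.+ (b ℕ.∸ a)) / 1      ≡⟨ cong (λ k → + k / 1) (ℕ.m+[n∸m]≡n a≤b) ⟩
  + b / 1                      ∎
  where open ≤-Reasoning

1/16*n≤j : ∀ {n} j → n ℕ.≤ 16 ℕ.* j → (+ 1 / 16) * (+ n / 1) ≤ + j / 1
1/16*n≤j {n} j n≤16j = begin
  (+ 1 / 16) * (+ n / 1)                 ≤⟨ *-monoˡ (0≤/ 1 16) (/1-mono-≤ n≤16j) ⟩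
  (+ 1 / 16) * (+ (16 ℕ.* j) / 1)        ≡⟨ cong ((+ 1 / 16) *_) (/1-homo-* 16 j) ⟩
  (+ 1 / 16) * ((+ 16 / 1) * (+ j / 1))  ≡⟨ *-assoc (+ 1 / 16) (+ 16 / 1) (+ j / 1) ⟨
  1ℚ * (+ j / 1)                         ≡⟨ *-identityˡ (+ j / 1) ⟩
  + j / 1                                ∎
  where open ≤-Reasoning

-- Cyclic rotation and geometric weights

-- A countdown: `suc j` goes to `inject₁ j`, one round closer to the centre, and the centre `zero`
-- goes to the last position.
turn : ∀ ℓ → Permutation′ (suc ℓ)
turn ℓ = insert zero (fromℕ ℓ) Perm.id

punchIn-fromℕ : ∀ {ℓ} (j : Fin ℓ) → punchIn (fromℕ ℓ) j ≡ inject₁ j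
punchIn-fromℕ zero    = refl
punchIn-fromℕ (suc j) = cong suc (punchIn-fromℕ j)

turnˡ-fromℕ : ∀ ℓ → turn ℓ ⟨$⟩ˡ fromℕ ℓ ≡ zero
turnˡ-fromℕ ℓ = Perm.inverseˡ (turn ℓ) {zero}

turnˡ-inject₁ : ∀ {ℓ} (j : Fin ℓ) → turn ℓ ⟨$⟩ˡ inject₁ j ≡ suc j
turnˡ-inject₁ {ℓ} j = begin
  turn ℓ ⟨$⟩ˡ inject₁ j                ≡⟨ cong (turn ℓ ⟨$⟩ˡ_) (punchIn-fromℕ j) ⟨
  turn ℓ ⟨$⟩ˡ punchIn (fromℕ ℓ) j      ≡⟨ cong (turn ℓ ⟨$⟩ˡ_) (insert-punchIn zero (fromℕ ℓ) Perm.id j) ⟨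
  turn ℓ ⟨$⟩ˡ (turn ℓ ⟨$⟩ʳ suc j)      ≡⟨ Perm.inverseˡ (turn ℓ) ⟩
  suc j                                ∎
  where open ≡-Reasoning

½^-nonNeg : ∀ k → 0ℚ ≤ ½ ^ k
½^-nonNeg = ^-nonNeg 0≤½

-- The bound reproduces itself: the sum for `suc ℓ` is 1 plus the left side for `ℓ`, and half of 1 +
-- 1 is 1.
½*geometric≤1 : ∀ ℓ → ½ * sum (λ (j : Fin ℓ) → ½ ^ toℕ j) ≤ 1ℚ
½*geometric≤1 zero    = 0≤1
½*geometric≤1 (suc ℓ) = *-monoˡ 0≤½ (+-monoʳ-≤ 1ℚ (≤-trans
  (≤-reflexive (sym (*-distribˡ-sum {ℓ} ½ λ j → ½ ^ toℕ j)))
  (½*geometric≤1 ℓ)))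

-- Rotating double stars

module DoubleStar (L : Bool → ℕ) where

  -- (s , j) is the vertex of side s that becomes the centre of its star in j rounds.
  Label : Set
  Label = Σ[ s ∈ Bool ] Fin (suc (L s))

  Adj : Label → Label → Set
  Adj (s , zero)  (s′ , zero)  = s ≢ s′
  Adj (s , zero)  (s′ , suc _) = s ≡ s′
  Adj (s , suc _) (s′ , zero)  = s ≡ s′
  Adj (s , suc _) (s′ , suc _) = ⊥

  Adj? : ∀ a b → Dec (Adj a b)
  Adj? (s , zero)  (s′ , zero)  = ¬? (s Bool.≟ s′)
  Adj? (s , zero)  (s′ , suc _) = s Bool.≟ s′
  Adj? (s , suc _) (s′ , zero)  = s Bool.≟ s′
  Adj? (s , suc _) (s′ , suc _) = no id

  Adj-sym : ∀ a b → Adj a b → Adj b a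
  Adj-sym (_ , zero)  (_ , zero)  = ≢-sym
  Adj-sym (_ , zero)  (_ , suc _) = sym
  Adj-sym (_ , suc _) (_ , zero)  = sym
  Adj-sym (_ , suc _) (_ , suc _) = id

  Adj-irrefl : ∀ a → ¬ Adj a a
  Adj-irrefl (_ , zero)  s≢s = s≢s refl
  Adj-irrefl (_ , suc _) ()

  Adj-neighbour : ∀ a → ∃[ b ] Adj a b
  Adj-neighbour (s , zero)  = (not s , zero) , Bool.not-¬ refl
  Adj-neighbour (s , suc _) = (s , zero) , refl

  Adj-leaf : ∀ {s j} b → Adj (s , suc j) b → b ≡ (s , zero)
  Adj-leaf (_ , zero) refl = refl

  centre-path : ∀ s j → Star Adj (s , j) (s , zero)
  centre-path s zero    = ε
  centre-path s (suc j) = refl ◅ ε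

  bridge-path : ∀ s s′ → Star Adj (s , zero) (s′ , zero)
  bridge-path false false = ε
  bridge-path false true  = (λ ()) ◅ ε
  bridge-path true  false = (λ ()) ◅ ε
  bridge-path true  true  = ε

  Adj-connected : ∀ a b → Star Adj a b
  Adj-connected (s , i) (s′ , j) = centre-path s i ◅◅ bridge-path s s′ ◅◅
    reverse (λ {a} {b} → Adj-sym a b) (centre-path s′ j)

  Labelling : ℕ → Set
  Labelling n = Fin n ↔ Label

  vertex : ∀ {n} → Labelling n → ∀ s → Fin (suc (L s)) → Fin n
  vertex ι s j = Inverse.from ι (s , j)

  graph : ∀ {n} → Labelling n → Graph n
  graph ι = record
    { _~_      = λ u v → Adj (to u) (to v)
    ; _~?_     = λ u v → Adj? (to u) (to v)
    ; ~-sym    = λ {u} {v} → Adj-sym (to u) (to v)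
    ; ~-irrefl = λ { {u} refl → Adj-irrefl (to u) }
    } where open Inverse ι

  module _ {n} (ι : Labelling n) where
    open Inverse ι
    open Graph (graph ι)

    Adj⇒~ : ∀ {a b} → Adj a b → from a ~ from b
    Adj⇒~ {a} {b} = subst₂ Adj (sym (strictlyInverseˡ a)) (sym (strictlyInverseˡ b))

    graph-connected : Connected
    graph-connected u v = subst₂ (Star _~_) (strictlyInverseʳ u) (strictlyInverseʳ v)
      (gmap from Adj⇒~ (Adj-connected (to u) (to v)))

    graph-neighbour : ∀ u → ∃[ v ] u ~ v
    graph-neighbour u with Adj-neighbour (to u)
    ... | b , a~b = from b , subst (Adj (to u)) (sym (strictlyInverseˡ b)) a~b

    leaf-neighbour : ∀ {s j} v → vertex ι s (suc j) ~ v → v ≡ vertex ι s zero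
    leaf-neighbour {s} {j} v leaf~v = trans (sym (strictlyInverseʳ v))
      (cong from (Adj-leaf (to v) (subst (λ a → Adj a (to v)) (strictlyInverseˡ (s , suc j)) leaf~v)))

  rotation : Label ↔ Label
  rotation = mk↔ₛ′
    (λ (s , j) → s , turn (L s) ⟨$⟩ʳ j) (λ (s , j) → s , turn (L s) ⟨$⟩ˡ j)
    (λ (s , j) → cong (s ,_) (Perm.inverseʳ (turn (L s))))
    (λ (s , j) → cong (s ,_) (Perm.inverseˡ (turn (L s))))

  rotate : ∀ {n} → Labelling n → Labelling n
  rotate ι = rotation ↔-∘ ι

  vertex-rotate-inject₁ : ∀ {n} (ι : Labelling n) s j →
    vertex (rotate ι) s (inject₁ j) ≡ vertex ι s (suc j)
  vertex-rotate-inject₁ ι s j = cong (vertex ι s) (turnˡ-inject₁ j)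

  vertex-rotate-fromℕ : ∀ {n} (ι : Labelling n) s →
    vertex (rotate ι) s (fromℕ (L s)) ≡ vertex ι s zero
  vertex-rotate-fromℕ ι s = cong (vertex ι s) (turnˡ-fromℕ (L s))

  -- The rotation is applied to the initial labelling before recursing, so `walk ι ∘ suc` is
  -- `walk (rotate ι)` by definition. This is the form that `𝔼-∷` produces.
  labelling : ∀ {n} → Labelling n → ℕ → Labelling n
  labelling ι zero    = ι
  labelling ι (suc t) = labelling (rotate ι) t

  walk : ∀ {n} → Labelling n → ℕ → Matrix n
  walk ι t = P-LS (graph (labelling ι t))

  P-LS-isDistribution : ∀ {n} (ι : Labelling n) u → IsDistribution (P-LS (graph ι) u)
  P-LS-isDistribution ι u = LazyWalk.isDistribution (graph ι) u (proj₂ (graph-neighbour ι u))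

  -- The allowance for growth of `Φ` in one round: the weights that the two old centres carry after
  -- moving to the last position of their sides.
  δ : ℚ
  δ = ½ ^ L false + ½ ^ L true

  δ-nonNeg : 0ℚ ≤ δ
  δ-nonNeg = +-nonNeg (½^-nonNeg (L false)) (½^-nonNeg (L true))

  -- The potential and its drift

  module _ {n} (target : Bool → Fin n) where

    defect : Bool → Fin n → ℚ
    defect s o = ind (¬? (o Fin.≟ target s))

    Φₛ : Labelling n → Config n → Bool → ℚ
    Φₛ ι x s = sum λ (j : Fin (suc (L s))) → ½ ^ toℕ j * defect s (lookup x (vertex ι s j))

    Φ : Labelling n → Config n → ℚ
    Φ ι x = Φₛ ι x false + Φₛ ι x true

    defect-nonNeg : ∀ s o → 0ℚ ≤ defect s o
    defect-nonNeg s o = ind-nonNeg (¬? (o Fin.≟ target s))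

    defect≤Φₛ : ∀ ι x s → defect s (lookup x (vertex ι s zero)) ≤ Φₛ ι x s
    defect≤Φₛ ι x s = ≤-trans
      (≤-reflexive (sym (*-identityˡ (defect s (lookup x (vertex ι s zero))))))
      (p≤p+q (sum-nonNeg λ j → *-nonNeg (½^-nonNeg (suc (toℕ j))) (defect-nonNeg s (lookup x (vertex ι s (suc j))))))

    Φₛ-nonNeg : ∀ ι x s → 0ℚ ≤ Φₛ ι x s
    Φₛ-nonNeg ι x s = ≤-trans (defect-nonNeg s (lookup x (vertex ι s zero))) (defect≤Φₛ ι x s)

    Φ-nonNeg : ∀ ι x → 0ℚ ≤ Φ ι x
    Φ-nonNeg ι x = +-nonNeg (Φₛ-nonNeg ι x false) (Φₛ-nonNeg ι x true)

    module _ (ι : Labelling n) (x : Config n) (s : Bool) where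
      private
        P = P-LS (graph ι)
        ℓ = L s

        d : Fin n → ℚ
        d v = defect s (lookup x v)

        -- The expected defect, with respect to side `s`, of the opinion that `u` holds after the
        -- round.
        F : Fin n → ℚ
        F u = sum λ v → P u v * d v

        v′ : Fin (suc ℓ) → Fin n
        v′ = vertex (rotate ι) s

        v : Fin (suc ℓ) → Fin n
        v = vertex ι s

        module E = IsExpectation (𝔼₁-isExpectation (P-LS-isDistribution ι))

      F-leaf : ∀ j → F (v (suc j)) ≤ ½ * d (v (suc j)) + ½ * d (v zero)
      F-leaf j = LazyWalk.step-≤ (graph ι) (v (suc j)) (Adj⇒~ ι {s , suc j} {s , zero} refl) d (d (v zero))
        λ w leaf~w → ≤-reflexive (cong d (leaf-neighbour ι w leaf~w))

      F-≤1 : ∀ u → F u ≤ 1ℚ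
      F-≤1 u = ≤-trans (R.mono λ w → ind-≤1 (¬? (lookup x w Fin.≟ target s))) (≤-reflexive (R.const 1ℚ))
        where module R = IsExpectation (distribution-expectation (P-LS-isDistribution ι u))

      𝔼₁-Φₛ : 𝔼₁ P (λ φ → Φₛ (rotate ι) (update φ x) s) ≡ sum λ j → ½ ^ toℕ j * F (v′ j)
      𝔼₁-Φₛ = begin
        𝔼₁ P (λ φ → Φₛ (rotate ι) (update φ x) s)
          ≡⟨ (E.≗-cong λ φ → sum-cong-≗ {suc ℓ} λ j →
               cong (λ o → ½ ^ toℕ j * defect s o) (lookup-map (v′ j) (lookup x) φ)) ⟩
        𝔼₁ P (λ φ → sum λ j → ½ ^ toℕ j * d (lookup φ (v′ j)))
          ≡⟨ E.sum-homo (λ j φ → ½ ^ toℕ j * d (lookup φ (v′ j))) ⟩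
        sum (λ j → 𝔼₁ P λ φ → ½ ^ toℕ j * d (lookup φ (v′ j)))
          ≡⟨ (sum-cong-≗ {suc ℓ} λ j → trans
               (E.*-homo (½ ^ toℕ j) λ φ → d (lookup φ (v′ j)))
               (cong (½ ^ toℕ j *_) (𝔼₁-marginal (P-LS-isDistribution ι) (v′ j) d))) ⟩
        sum (λ j → ½ ^ toℕ j * F (v′ j)) ∎
        where open ≡-Reasoning

      -- A leaf doubles its weight by advancing one position, but keeps its own defect only with
      -- probability 1/2, so its own share is unchanged. The shares copied from the centre have
      -- total weight at most 1, which is the weight of the centre before the round. What remains is
      -- the old centre itself, now at weight `½ ^ ℓ`.
      Φₛ-drift : 𝔼₁ P (λ φ → Φₛ (rotate ι) (update φ x) s) ≤ Φₛ ι x s + ½ ^ ℓ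
      Φₛ-drift = begin
        𝔼₁ P (λ φ → Φₛ (rotate ι) (update φ x) s)
          ≡⟨ 𝔼₁-Φₛ ⟩
        sum (λ j → ½ ^ toℕ j * F (v′ j))
          -- The last position is split off because the old centre occupies it; the others hold the
          -- former leaves.
          ≡⟨ sum-init-last {ℓ} (λ j → ½ ^ toℕ j * F (v′ j)) ⟩
        sum (λ j → ½ ^ toℕ (inject₁ j) * F (v′ (inject₁ j))) + ½ ^ toℕ (fromℕ ℓ) * F (v′ (fromℕ ℓ))
          ≡⟨ cong₂ _+_
               (sum-cong-≗ {ℓ} λ j → cong₂ (λ k u → ½ ^ k * F u) (Fin.toℕ-inject₁ j) (vertex-rotate-inject₁ ι s j))
               (cong₂ (λ k u → ½ ^ k * F u) (Fin.toℕ-fromℕ ℓ) (vertex-rotate-fromℕ ι s)) ⟩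
        sum (λ j → ½ ^ toℕ j * F (v (suc j))) + ½ ^ ℓ * F (v zero)
          ≤⟨ +-mono-≤
               (sum-mono λ j → *-monoˡ (½^-nonNeg (toℕ j)) (F-leaf j))
               -- The centre may copy across the bridge, so its defect is bounded only by 1.
               (*-monoˡ (½^-nonNeg ℓ) (F-≤1 (v zero))) ⟩
        sum (λ j → ½ ^ toℕ j * (½ * d (v (suc j)) + ½ * d (v zero))) + ½ ^ ℓ * 1ℚ
          ≡⟨ cong₂ _+_
               (sum-cong-≗ {ℓ} λ j → expand (½ ^ toℕ j) ½ (d (v (suc j))) (d (v zero)))
               (*-identityʳ (½ ^ ℓ)) ⟩
        sum (λ j → ½ ^ suc (toℕ j) * d (v (suc j)) + ½ ^ suc (toℕ j) * d (v zero)) + ½ ^ ℓ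
          ≡⟨ cong (λ p → p + ½ ^ ℓ) (∑-distrib-+ {ℓ}
               (λ j → ½ ^ suc (toℕ j) * d (v (suc j)))
               (λ j → ½ ^ suc (toℕ j) * d (v zero))) ⟩
        leaves + sum {ℓ} (λ j → ½ ^ suc (toℕ j) * d (v zero)) + ½ ^ ℓ
          ≡⟨ cong (λ p → leaves + p + ½ ^ ℓ) (trans
               (cong (_* d (v zero)) (*-distribˡ-sum {ℓ} ½ λ j → ½ ^ toℕ j))
               (*-distribʳ-sum {ℓ} (d (v zero)) λ j → ½ ^ suc (toℕ j))) ⟨
        leaves + ½ * sum {ℓ} (λ j → ½ ^ toℕ j) * d (v zero) + ½ ^ ℓ
          ≤⟨ +-monoˡ-≤ (½ ^ ℓ) (+-monoʳ-≤ leaves (*-monoʳ-≤-nonNeg (d (v zero))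
               {{nonNegative (defect-nonNeg s (lookup x (v zero)))}} (½*geometric≤1 ℓ))) ⟩
        leaves + 1ℚ * d (v zero) + ½ ^ ℓ
          -- With the centre first, this is the unfolded sum `Φₛ ι x s`, whose leading weight
          -- `½ ^ 0` is 1.
          ≡⟨ cong (λ p → p + ½ ^ ℓ) (+-comm leaves (1ℚ * d (v zero))) ⟩
        Φₛ ι x s + ½ ^ ℓ ∎
        where
        open ≤-Reasoning
        leaves = sum {ℓ} λ j → ½ ^ suc (toℕ j) * d (v (suc j))
        expand : ∀ a h y z → a * (h * y + h * z) ≡ h * a * y + h * a * z
        expand = solve 4 (λ a h y z → a :* (h :* y :+ h :* z) := h :* a :* y :+ h :* a :* z) refl

    Φ-drift : ∀ ι x → 𝔼₁ (P-LS (graph ι)) (λ φ → Φ (rotate ι) (update φ x)) ≤ Φ ι x + δ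
    Φ-drift ι x = begin
      𝔼₁ P (λ φ → Φ (rotate ι) (update φ x))
        ≡⟨ E.+-homo (λ φ → Φₛ (rotate ι) (update φ x) false) (λ φ → Φₛ (rotate ι) (update φ x) true) ⟩
      𝔼₁ P (λ φ → Φₛ (rotate ι) (update φ x) false) + 𝔼₁ P (λ φ → Φₛ (rotate ι) (update φ x) true)
        ≤⟨ +-mono-≤ (Φₛ-drift ι x false) (Φₛ-drift ι x true) ⟩
      Φₛ ι x false + ½ ^ L false + (Φₛ ι x true + ½ ^ L true)
        ≡⟨ interchange (Φₛ ι x false) (½ ^ L false) (Φₛ ι x true) (½ ^ L true) ⟩
      Φ ι x + δ ∎
      where
      open ≤-Reasoning
      P = P-LS (graph ι)
      module E = IsExpectation (𝔼₁-isExpectation (P-LS-isDistribution ι))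
      interchange : ∀ a b c e → a + b + (c + e) ≡ a + c + (b + e)
      interchange = solve 4 (λ a b c e → a :+ b :+ (c :+ e) := a :+ c :+ (b :+ e)) refl

    -- Lower bound on the truncated consensus time

    module _ (target-distinct : target false ≢ target true) where

      1≤defects : ∀ o → 1ℚ ≤ defect false o + defect true o
      1≤defects o with o Fin.≟ target false | o Fin.≟ target true
      ... | yes o≡f | yes o≡t = contradiction (trans (sym o≡f) o≡t) target-distinct
      ... | yes _   | no  _   = ≤-refl
      ... | no  _   | o≟t     = p≤p+q (ind-nonNeg (¬? o≟t))

      consensus⇒1≤Φ : ∀ ι x → Consensus x → 1ℚ ≤ Φ ι x
      consensus⇒1≤Φ ι x c = ≤-trans (1≤defects (lookup x (vertex ι false zero))) (+-mono-≤
        (defect≤Φₛ ι x false)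
        (≤-trans
          (≤-reflexive (cong (defect true) (c (vertex ι false zero) (vertex ι true zero))))
          (defect≤Φₛ ι x true)))

      -- E[min(τ,T)] ≥ T (1 - Φ - T δ), without subtraction.
      horizon-bound : ∀ T ι x →
        + T / 1 ≤ 𝔼 (walk ι) T (λ ω → + τ∧ T x ω / 1) + (+ T / 1) * (Φ ι x + (+ T / 1) * δ)
      horizon-bound zero ι x = ≤-reflexive (sym (cong (_+_ 0ℚ) (*-zeroˡ (Φ ι x + 0ℚ * δ))))
      horizon-bound (suc T) ι x = bound (consensus? x)
        where
        open ≤-Reasoning
        N N⁺ : ℚ
        N  = + T / 1
        N⁺ = + suc T / 1

        0≤N : 0ℚ ≤ N
        0≤N = 0≤/ T 1

        0≤N⁺ : 0ℚ ≤ N⁺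
        0≤N⁺ = 0≤/ (suc T) 1

        N⁺≡1+N : N⁺ ≡ 1ℚ + N
        N⁺≡1+N = /1-homo-+ 1 T

        P = P-LS (graph ι)

        𝔼τ : ℚ
        𝔼τ = 𝔼 (walk ι) (suc T) λ ω → + τ∧ (suc T) x ω / 1

        𝔼τ′ : Picks n → ℚ
        𝔼τ′ φ = 𝔼 (walk (rotate ι)) T λ ω → + τ∧ T (update φ x) ω / 1

        Φ′ : Picks n → ℚ
        Φ′ φ = Φ (rotate ι) (update φ x)

        module E₁ = IsExpectation (𝔼₁-isExpectation (P-LS-isDistribution ι))
        module E′ = IsExpectation (𝔼-isExpectation (λ t → P-LS-isDistribution (labelling (rotate ι) t)) T)
        module E  = IsExpectation (𝔼-isExpectation (λ t → P-LS-isDistribution (labelling ι t)) (suc T))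

        0≤𝔼τ : 0ℚ ≤ 𝔼τ
        0≤𝔼τ = ≤-trans (≤-reflexive (sym (E.const 0ℚ))) (E.mono λ ω → 0≤/ (τ∧ (suc T) x ω) 1)

        -- Without consensus this round counts 1, and the remaining time is that of the updated
        -- configuration under the rotated walk.
        𝔼τ-step : ¬ Consensus x → 𝔼τ ≡ 1ℚ + 𝔼₁ P 𝔼τ′
        𝔼τ-step ¬c = begin-equality
          𝔼τ
            ≡⟨ E.≗-cong {λ ω → + τ∧ (suc T) x ω / 1} {1+τ} (λ { (φ ∷ ω) → trans
                 (cong (λ t → + t / 1) (τ∧-step ¬c φ ω))
                 (/1-homo-+ 1 (τ∧ T (update φ x) ω)) }) ⟩
          𝔼 (walk ι) (suc T) 1+τ
            ≡⟨ 𝔼-∷ (walk ι) T 1+τ ⟩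
          𝔼₁ P (λ φ → 𝔼 (walk (rotate ι)) T λ ω → 1ℚ + + τ∧ T (update φ x) ω / 1)
            ≡⟨ (E₁.≗-cong λ φ → trans
                 (E′.+-homo (λ _ → 1ℚ) (λ ω → + τ∧ T (update φ x) ω / 1))
                 (cong (λ p → p + 𝔼τ′ φ) (E′.const 1ℚ))) ⟩
          𝔼₁ P (λ φ → 1ℚ + 𝔼τ′ φ)
            ≡⟨ E₁.+-homo (λ _ → 1ℚ) 𝔼τ′ ⟩
          𝔼₁ P (λ _ → 1ℚ) + 𝔼₁ P 𝔼τ′
            ≡⟨ cong (λ p → p + 𝔼₁ P 𝔼τ′) (E₁.const 1ℚ) ⟩
          1ℚ + 𝔼₁ P 𝔼τ′ ∎
          where
          1+τ : Vec (Picks n) (suc T) → ℚ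
          1+τ (φ ∷ ω) = 1ℚ + + τ∧ T (update φ x) ω / 1

          τ∧-step : ¬ Consensus x → ∀ φ ω → τ∧ (suc T) x (φ ∷ ω) ≡ suc (τ∧ T (update φ x) ω)
          τ∧-step ¬c φ ω with consensus? x
          ... | yes c = contradiction c ¬c
          ... | no  _ = refl

        -- The bound for horizon `T` from the updated configuration, averaged over the first round;
        -- the drift then replaces the expected new potential by `Φ ι x + δ`.
        induction : N ≤ 𝔼₁ P 𝔼τ′ + N * (Φ ι x + δ + N * δ)
        induction = begin
          N
            ≡⟨ E₁.const N ⟨
          𝔼₁ P (λ _ → N)
            ≤⟨ (E₁.mono λ φ → horizon-bound T (rotate ι) (update φ x)) ⟩
          𝔼₁ P (λ φ → 𝔼τ′ φ + N * (Φ′ φ + N * δ))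
            ≡⟨ E₁.+-homo 𝔼τ′ (λ φ → N * (Φ′ φ + N * δ)) ⟩
          𝔼₁ P 𝔼τ′ + 𝔼₁ P (λ φ → N * (Φ′ φ + N * δ))
            ≡⟨ cong (_+_ (𝔼₁ P 𝔼τ′)) (E₁.*-homo N λ φ → Φ′ φ + N * δ) ⟩
          𝔼₁ P 𝔼τ′ + N * 𝔼₁ P (λ φ → Φ′ φ + N * δ)
            ≡⟨ cong (λ p → 𝔼₁ P 𝔼τ′ + N * p) (trans
                 (E₁.+-homo Φ′ λ _ → N * δ)
                 (cong (_+_ (𝔼₁ P Φ′)) (E₁.const (N * δ)))) ⟩
          𝔼₁ P 𝔼τ′ + N * (𝔼₁ P Φ′ + N * δ)
            ≤⟨ +-monoʳ-≤ (𝔼₁ P 𝔼τ′) (*-monoˡ 0≤N (+-monoˡ-≤ (N * δ) (Φ-drift ι x))) ⟩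
          𝔼₁ P 𝔼τ′ + N * (Φ ι x + δ + N * δ) ∎

        0≤Φ+N⁺δ : 0ℚ ≤ Φ ι x + N⁺ * δ
        0≤Φ+N⁺δ = +-nonNeg (Φ-nonNeg ι x) (*-nonNeg 0≤N⁺ δ-nonNeg)

        bound : Dec (Consensus x) → N⁺ ≤ 𝔼τ + N⁺ * (Φ ι x + N⁺ * δ)
        -- Here the elapsed time is 0, but `Φ ι x` is at least 1, so the loss term alone covers
        -- `N⁺`.
        bound (yes c) = begin
          N⁺                            ≡⟨ *-identityʳ N⁺ ⟨
          N⁺ * 1ℚ                       ≤⟨ *-monoˡ 0≤N⁺ (consensus⇒1≤Φ ι x c) ⟩
          N⁺ * Φ ι x                    ≤⟨ *-monoˡ 0≤N⁺ (p≤p+q (*-nonNeg 0≤N⁺ δ-nonNeg)) ⟩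
          N⁺ * (Φ ι x + N⁺ * δ)         ≤⟨ p≤q+p 0≤𝔼τ ⟩
          𝔼τ + N⁺ * (Φ ι x + N⁺ * δ)    ∎
        bound (no ¬c) = begin
          N⁺
            ≡⟨ N⁺≡1+N ⟩
          1ℚ + N
            ≤⟨ +-monoʳ-≤ 1ℚ induction ⟩
          1ℚ + (𝔼₁ P 𝔼τ′ + N * (Φ ι x + δ + N * δ))
            -- The `δ` gained in this round joins `N * δ` to give `N⁺ * δ`; afterwards only the
            -- outer factor `N` has to be enlarged to `N⁺`.
            ≡⟨ regroup (𝔼₁ P 𝔼τ′) N (Φ ι x) δ ⟩
          1ℚ + 𝔼₁ P 𝔼τ′ + N * (Φ ι x + (1ℚ + N) * δ)
            ≡⟨ cong₂ (λ p r → p + N * (Φ ι x + r * δ)) (𝔼τ-step ¬c) N⁺≡1+N ⟨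
          𝔼τ + N * (Φ ι x + N⁺ * δ)
            ≤⟨ +-monoʳ-≤ 𝔼τ (*-monoʳ-≤-nonNeg (Φ ι x + N⁺ * δ) {{nonNegative 0≤Φ+N⁺δ}}
                 (≤-trans (p≤q+p {N} {1ℚ} 0≤1) (≤-reflexive (sym N⁺≡1+N)))) ⟩
          𝔼τ + N⁺ * (Φ ι x + N⁺ * δ) ∎
          where
          regroup : ∀ e m f d → 1ℚ + (e + m * (f + d + m * d)) ≡ 1ℚ + e + m * (f + (1ℚ + m) * d)
          regroup = solve 4 (λ e m f d →
            con 1ℚ :+ (e :+ m :* (f :+ d :+ m :* d)) := con 1ℚ :+ e :+ m :* (f :+ (con 1ℚ :+ m) :* d)) refl

  -- The split initial configuration

  module _ {n} (ι : Labelling n) where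
    open Inverse ι

    -- Opinions are elements of `Fin n`, so each side names its opinion after its initial centre;
    -- this makes the two opinions distinct.
    target : Bool → Fin n
    target s = vertex ι s zero

    target-distinct : target false ≢ target true
    target-distinct eq = contradiction
      (trans (sym (strictlyInverseˡ (false , zero))) (trans (cong to eq) (strictlyInverseˡ (true , zero))))
      λ ()

    split-config : Config n
    split-config = tabulate λ u → target (proj₁ (to u))

    Φ-split≡0 : Φ target ι split-config ≡ 0ℚ
    Φ-split≡0 = cong₂ _+_ (side false) (side true)
      where
      no-defect : ∀ s j → defect target s (lookup split-config (vertex ι s j)) ≡ 0ℚ
      no-defect s j = trans
        (cong (defect target s) (trans
          (lookup∘tabulate (λ u → target (proj₁ (to u))) (vertex ι s j))
          (cong (target ∘ proj₁) (strictlyInverseˡ (s , j)))))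
        (defect-target s)
        where
        defect-target : ∀ s → defect target s (target s) ≡ 0ℚ
        defect-target s with target s Fin.≟ target s
        ... | yes _ = refl
        ... | no ¬p = contradiction refl ¬p

      side : ∀ s → Φₛ target ι split-config s ≡ 0ℚ
      side s = trans
        (sum-cong-≗ {suc (L s)} λ j → trans (cong (½ ^ toℕ j *_) (no-defect s j)) (*-zeroʳ (½ ^ toℕ j)))
        (sum-replicate-zero (suc (L s)))

    long-consensus : ∀ T → + T / 1 ≤
      𝔼 (walk ι) T (λ ω → + τ∧ T split-config ω / 1) + (+ T / 1) * ((+ T / 1) * δ)
    long-consensus T = ≤-trans (horizon-bound target target-distinct T ι split-config) (≤-reflexive
      (cong (λ p → 𝔼 (walk ι) T (λ ω → + τ∧ T split-config ω / 1) + (+ T / 1) * p)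
        (trans (cong (λ p → p + (+ T / 1) * δ) Φ-split≡0) (+-identityˡ ((+ T / 1) * δ)))))

-- Choice of sizes and horizon

module TwoHalves (i i′ : ℕ) (i≤i′ : i ℕ.≤ i′) where

  L : Bool → ℕ
  L false = 4 ℕ.+ i
  L true  = 4 ℕ.+ i′

  open DoubleStar L

  n j : ℕ
  n = suc (L false) ℕ.+ suc (L true)
  j = suc i

  ⊎↔Label : (Fin (suc (L false)) ⊎ Fin (suc (L true))) ↔ Label
  ⊎↔Label = mk↔ₛ′
    (λ { (inj₁ k) → false , k ; (inj₂ k) → true , k })
    (λ { (false , k) → inj₁ k ; (true , k) → inj₂ k })
    (λ { (false , _) → refl ; (true , _) → refl })
    (λ { (inj₁ _) → refl ; (inj₂ _) → refl })

  ι₀ : Labelling n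
  ι₀ = ⊎↔Label ↔-∘ Fin.+↔⊎

  -- The smaller side dominates: `δ` is at most `2 * ½ ^ (4 + i)`, and the offset 4 in `L` makes
  -- this `½ ^ (i + 3)`, half of `½ ^ suc j`.
  2^*δ≤½ : 2ℚ ^ suc j * δ ≤ ½
  2^*δ≤½ = begin
    2ℚ ^ k * (½ ^ (2 ℕ.+ k) + ½ ^ (4 ℕ.+ i′))
      ≤⟨ *-monoˡ (^-nonNeg 0≤2 k) (+-monoʳ-≤ (½ ^ (2 ℕ.+ k)) (½^-anti-≤ (ℕ.+-monoʳ-≤ 4 i≤i′))) ⟩
    2ℚ ^ k * (½ ^ (2 ℕ.+ k) + ½ ^ (2 ℕ.+ k))
      ≡⟨ regroup (2ℚ ^ k) (½ ^ k) ⟩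
    ½ * (2ℚ ^ k * ½ ^ k)
      ≡⟨ cong (½ *_) (2^*½^ k) ⟩
    ½ * 1ℚ ∎
    where
    open ≤-Reasoning
    k = suc j
    regroup : ∀ x y → x * (½ * (½ * y) + ½ * (½ * y)) ≡ ½ * (x * y)
    regroup = solve 2 (λ x y → x :* (con ½ :* (con ½ :* y) :+ con ½ :* (con ½ :* y)) := con ½ :* (x :* y)) refl

  -- The horizon at which the loss T² δ in horizon-bound is at most T / 2 = 2^j.
  T : ℕ
  T = 2 ℕ.^ suc j

  𝔼τ : ℚ
  𝔼τ = 𝔼 (walk ι₀) T λ ω → + τ∧ T (split-config ι₀) ω / 1

  2^j≤𝔼τ : 2ℚ ^ j ≤ 𝔼τ
  -- With `T = 2y` the bound reads `2y ≤ 𝔼τ + y`; adding `y` to the assumption `𝔼τ < y` contradicts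
  -- it without subtraction.
  2^j≤𝔼τ = ≮⇒≥ λ 𝔼τ<y → <-irrefl refl (<-≤-trans (+-monoˡ-< y 𝔼τ<y) (begin
    y + y                            ≡⟨ double y ⟩
    2ℚ * y                           ≡⟨ /1-2^ (suc j) ⟨
    + T / 1                          ≤⟨ long-consensus ι₀ T ⟩
    𝔼τ + (+ T / 1) * ((+ T / 1) * δ) ≡⟨ cong (λ N → 𝔼τ + N * (N * δ)) (/1-2^ (suc j)) ⟩
    𝔼τ + 2ℚ * y * (2ℚ * y * δ)       ≤⟨ +-monoʳ-≤ 𝔼τ (*-monoˡ (^-nonNeg 0≤2 (suc j)) 2^*δ≤½) ⟩
    𝔼τ + 2ℚ * y * ½                  ≡⟨ cong (_+_ 𝔼τ) (halve y) ⟩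
    𝔼τ + y                           ∎))
    where
    open ≤-Reasoning
    y = 2ℚ ^ j
    double : ∀ y → y + y ≡ 2ℚ * y
    double = solve 1 (λ y → y :+ y := con 2ℚ :* y) refl
    halve : ∀ y → 2ℚ * y * ½ ≡ y
    halve = solve 1 (λ y → con 2ℚ :* y :* con ½ := y) refl

  -- The split configuration and the horizon `T` are the witnesses for the two suprema.
  t-cons-≥ : ∀ {e} → e ≤ + j / 1 → 2^ℚ e ≼ t-cons (walk ι₀)
  t-cons-≥ e≤j q∈ = split-config ι₀ , T , <-≤-trans (2^ℚ-< j e≤j q∈) 2^j≤𝔼τ

proposition1p9 : ∃[ c ] Positive c × ∃[ n₀ ] (∀ n → n ≥ n₀ →
    Σ[ G ∈ (ℕ → Graph n) ]
    (∀ t → Graph.Connected (G t)) ×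
    2^ℚ (c * (+ n / 1)) ≼ t-cons (λ t → P-LS (G t)))
-- The sides have `5 + i` and `5 + i′` vertices, hence the threshold 10. Since `i′ ≤ i + 1`, `n` is
-- at most `11 + 2i`, hence at most `16 * (i + 1) = 16 * j`, which gives `c = 1/16`.
proposition1p9 = + 1 / 16 , _ , 10 , λ n n≥10 →
  let m = n ℕ.∸ 10 in
  subst Goal
    (trans (halves ℕ.⌊ m /2⌋ ℕ.⌈ m /2⌉) (trans (cong (10 ℕ.+_) (ℕ.⌊n/2⌋+⌈n/2⌉≡n m)) (ℕ.m+[n∸m]≡n n≥10)))
    -- The last argument is `⌈ m /2⌉ ≤ suc ⌊ m /2⌋`: by definition these are the floors of half of
    -- `suc m` and of `suc (suc m)`.
    (main ℕ.⌊ m /2⌋ ℕ.⌈ m /2⌉ (ℕ.⌊n/2⌋≤⌈n/2⌉ m) (ℕ.⌊n/2⌋-mono (ℕ.n≤1+n (suc m))))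
  where
  Goal : ℕ → Set₁
  Goal n = Σ[ G ∈ (ℕ → Graph n) ]
    (∀ t → Graph.Connected (G t)) × 2^ℚ ((+ 1 / 16) * (+ n / 1)) ≼ t-cons (λ t → P-LS (G t))

  halves : ∀ i i′ → (5 ℕ.+ i) ℕ.+ (5 ℕ.+ i′) ≡ 10 ℕ.+ (i ℕ.+ i′)
  halves = solve-∀

  main : ∀ i i′ → i ℕ.≤ i′ → i′ ℕ.≤ suc i → Goal ((5 ℕ.+ i) ℕ.+ (5 ℕ.+ i′))
  main i i′ i≤i′ i′≤1+i =
    (λ t → graph (labelling ι₀ t)) ,
    (λ t → graph-connected (labelling ι₀ t)) ,
    t-cons-≥ (1/16*n≤j j n≤16j)
    where
    open TwoHalves i i′ i≤i′
    open DoubleStar L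
    n≤16j : n ℕ.≤ 16 ℕ.* j
    n≤16j = begin
      (5 ℕ.+ i) ℕ.+ (5 ℕ.+ i′)                       ≤⟨ ℕ.+-monoʳ-≤ (5 ℕ.+ i) (ℕ.+-monoʳ-≤ 5 i′≤1+i) ⟩
      (5 ℕ.+ i) ℕ.+ (5 ℕ.+ suc i)                    ≤⟨ ℕ.m≤m+n _ (5 ℕ.+ 14 ℕ.* i) ⟩
      (5 ℕ.+ i) ℕ.+ (5 ℕ.+ suc i) ℕ.+ (5 ℕ.+ 14 ℕ.* i) ≡⟨ total i ⟩
      16 ℕ.* j                                       ∎
      where
      open ℕ.≤-Reasoning
      total : ∀ i → (5 ℕ.+ i) ℕ.+ (5 ℕ.+ suc i) ℕ.+ (5 ℕ.+ 14 ℕ.* i) ≡ 16 ℕ.* suc i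
      total = solve-∀
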